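{- For every positive integer $n$, the number of minimal separating families of maximum size (i.e. of largest cardinality among all minimal separating families) for an $n$-element set is $n^{n-2}$.
   Context: A bipartition of a set $S$ is a partition of $S$ into at most two nonempty components (so $\{S\}$ is a bipartition). A bipartition cuts two elements if they lie in different components. A family $\mathcal{P}$ of bipartitions of a finite set $S$ is a separating family for $S$ if every two distinct elements of $S$ are cut by some bipartition in $\mathcal{P}$; it is minimal if no proper subfamily is a separating family for $S$. -}

module Defs where

open import Data.Nat using (ℕ; zero; suc; _^_; _≤_; _+_)
open import Data.Nat.Properties using (+-identityʳ)
open import Data.Fin using (Fin; splitAt; cast)
open import Data.Fin.Subset using (Subset; inside; outside; _∈_; _⊂_; ∣_∣)
open import Data.Vec using (Vec; []; _∷_; lookup)
open import Data.Sum using (inj₁; inj₂)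
open import Data.Product using (_×_; ∃-syntax)
open import Data.Bool using (Bool)
open import Relation.Binary.PropositionalEquality using (_≡_; _≢_)
open import Relation.Nullary using (¬_)

-- Ground set: S = Fin (suc m), an n-element set with n = suc m ≥ 1.
--
-- A bipartition {A, S \ A} of S (at most two nonempty components) is
-- determined by the component A containing the element zero; A is
-- zero together with an arbitrary subset of the other m elements.
-- We record a bipartition by its side-vector  inside ∷ B  (B : Subset m),
-- which is the characteristic vector of the component containing zero.
-- B = all inside gives the trivial bipartition {S}.
-- This is a bijection between Subset m and the bipartitions of S.

Bipartition : ℕ → Set
Bipartition m = Subset m

component₀ : ∀ {m} → Bipartition m → Subset (suc m)
component₀ B = inside ∷ B

Cuts : ∀ {m} → Bipartition m → Fin (suc m) → Fin (suc m) → Set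
Cuts B i j = lookup (component₀ B) i ≢ lookup (component₀ B) j

-- Enumeration of all 2^m bipartitions, i.e. of all subsets of Fin m
-- (a bijection Fin (2 ^ m) → Subset m, binary-digit style).
bip : ∀ m → Fin (2 ^ m) → Bipartition m
bip zero    _ = []
bip (suc m) k with splitAt (2 ^ m) k
... | inj₁ a = outside ∷ bip m a
... | inj₂ b = inside ∷ bip m (cast (+-identityʳ (2 ^ m)) b)

-- A family of bipartitions of S is a set of bipartitions, encoded as a
-- subset of the index set Fin (2 ^ m) of the enumeration `bip m`.
Family : ℕ → Set
Family m = Subset (2 ^ m)

Separating : ∀ {m} → Family m → Set
Separating {m} F =
  ∀ (i j : Fin (suc m)) → i ≢ j → ∃[ k ] (k ∈ F × Cuts (bip m k) i j)

MinimalSeparating : ∀ {m} → Family m → Set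
MinimalSeparating {m} F = Separating {m} F × (∀ (G : Family m) → G ⊂ F → ¬ Separating {m} G)

size : ∀ {m} → Family m → ℕ
size F = ∣ F ∣

MaxMinimalSeparating : ∀ {m} → Family m → Set
MaxMinimalSeparating {m} F =
  MinimalSeparating {m} F × (∀ (G : Family m) → MinimalSeparating {m} G → size {m} G ≤ size {m} F)

{-# OPTIONS --safe #-}

-- In a minimal separating family every bipartition k has a private pair of
-- elements, cut by k and by no other member.  Contracting one private pair
-- leaves such a system on one element fewer, so a family on n elements has at
-- most n - 1 members, and with exactly n - 1 members the private pairs connect
-- all elements, i.e. form a tree.  Every bipartition then cuts a single edge of
-- the tree, so the largest families are the fundamental cuts of the labelled
-- trees on n vertices.  Rooting a tree at zero, the vertex v ≠ zero corresponds
-- to the cut of the edge from v to its parent, and Prüfer codes count the trees.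
module Submission where

open import Defs
open import Data.Nat using (ℕ; suc; _^_; _∸_)
open import Data.List using (List; length)
open import Data.List.Membership.Propositional using (_∈_)
open import Data.List.Relation.Unary.Unique.Propositional using (Unique)
open import Data.Product using (_×_; ∃-syntax)
open import Function.Bundles using (_⇔_)
open import Relation.Binary.PropositionalEquality using (_≡_)

open import Data.Bool using (Bool; true; false; not; _∧_; _∨_; _xor_)
import Data.Bool.Properties as Bool
open import Data.Fin using (Fin; zero; suc; _≟_; _<_; punchIn; punchOut; splitAt; cast; fromℕ<; combine;
  finToFun; funToFin; _↑ˡ_; _↑ʳ_)
open import Data.Fin.Properties using (all?; any?; 0≢1+n; suc-injective; toℕ-injective; toℕ-inject;
  toℕ-fromℕ<; <-cmp; ¬∀⟶∃¬; ¬∀⟶∃¬-smallest; injective⇒≤; punchIn-injective; punchOut-injective;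
  punchIn-punchOut; cast-involutive; splitAt-↑ˡ; splitAt-↑ʳ; splitAt⁻¹-↑ˡ; splitAt⁻¹-↑ʳ; funToFin-finToFin;
  finToFun-funToFin)
open import Data.Fin.Subset using (Subset; inside; outside; ∣_∣; _-_; _⊂_) renaming (_∈_ to _∈ˢ_; _⊆_ to _⊆ˢ_)
open import Data.Fin.Subset.Properties using (_∈?_; ⊆-antisym; x∈p⇒p-x⊂p; x∈p∧x≢y⇒x∈p-y)
import Data.List as List
open import Data.List.Properties using (length-tabulate)
open import Data.List.Membership.Propositional.Properties using (∈-tabulate⁺; ∈-tabulate⁻)
open import Data.List.Relation.Unary.Unique.Propositional.Properties using (tabulate⁺)
open import Data.Nat using (zero; _+_; _≤_; z≤n; s≤s) renaming (_<_ to _<ℕ_)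
open import Data.Nat.Properties using (+-identityʳ; ≤-antisym; ≤-trans; ≤-refl; 1+n≰n; <⇒≱)
open import Data.Product using (∃; ∃₂; _,_; proj₁; proj₂)
open import Data.Sum using (inj₁; inj₂)
open import Data.Vec using (Vec; []; _∷_; lookup; tabulate; replicate; head; tail; map; here; there)
  renaming (insertAt to insertAtᵛ; removeAt to removeAtᵛ)
open import Data.Vec.Functional using (insertAt)
open import Data.Vec.Functional.Properties using (insertAt-lookup; insertAt-punchIn)
import Data.Vec.Properties as Vec
open import Function using (_∘_; id; flip)
open import Function.Bundles using (mk⇔)
open import Function.Definitions using (Injective)
open import Relation.Binary.Definitions using (tri<; tri≈; tri>)
open import Relation.Binary.PropositionalEquality using (_≢_; _≗_; refl; sym; trans; cong; cong₂; subst)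
open import Relation.Nullary using (¬_; Dec; does; yes; no; contradiction; ¬?)
open import Relation.Nullary.Decidable using (_×-dec_; _→-dec_; dec-true; map′; decidable-stable)

variable
  A : Set
  k m n s : ℕ

-- Finite sets and vectors

punchIn-cover : ∀ {P : Fin (suc n) → Set} l → P l → (∀ v → P (punchIn l v)) → ∀ v → P v
punchIn-cover {P = P} l Pl Pin v with l ≟ v
... | yes refl = Pl
... | no  l≢v  = subst P (punchIn-punchOut l≢v) (Pin (punchOut l≢v))

injective⇒surjective : {f : Fin n → Fin n} → Injective _≡_ _≡_ f → ∀ y → ∃[ x ] f x ≡ y
injective⇒surjective {suc n} {f} inj y with any? (λ x → f x ≟ y)
... | yes hit = hit
... | no  miss = contradiction (injective⇒≤ omit-injective) 1+n≰n
  where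
  y≢f : ∀ x → y ≢ f x
  y≢f x eq = miss (x , sym eq)
  omit-injective : Injective _≡_ _≡_ (λ x → punchOut (y≢f x))
  omit-injective {x} {x′} eq = inj (punchOut-injective (y≢f x) (y≢f x′) eq)

lookup-injective : {xs ys : Vec A n} → (∀ i → lookup xs i ≡ lookup ys i) → xs ≡ ys
lookup-injective {xs = xs} {ys} eq =
  trans (sym (Vec.tabulate∘lookup xs)) (trans (Vec.tabulate-cong eq) (Vec.tabulate∘lookup ys))

funToFin-cong : {f g : Fin m → Fin n} → f ≗ g → funToFin f ≡ funToFin g
funToFin-cong {zero}  eq = refl
funToFin-cong {suc m} eq = cong₂ combine (eq zero) (funToFin-cong (eq ∘ suc))

vector : Fin (n ^ k) → Vec (Fin n) k
vector {n} {k} i = tabulate (finToFun {n} {k} i)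

vector-injective : Injective _≡_ _≡_ (vector {n} {k})
vector-injective {n} {k} {i} {j} eq =
  trans (sym (funToFin-finToFin {k} {n} i)) (trans (funToFin-cong fun-eq) (funToFin-finToFin {k} {n} j))
  where
  fun-eq : finToFun {n} {k} i ≗ finToFun j
  fun-eq x = trans (sym (Vec.lookup∘tabulate _ x)) (trans (cong (flip lookup x) eq) (Vec.lookup∘tabulate _ x))

vector-surjective : (xs : Vec (Fin n) k) → ∃[ i ] vector i ≡ xs
vector-surjective xs =
  funToFin (lookup xs) , trans (Vec.tabulate-cong (finToFun-funToFin (lookup xs))) (Vec.tabulate∘lookup xs)

enum : (F : Subset n) → Fin ∣ F ∣ → Fin n
enum (inside  ∷ F) zero    = zero
enum (inside  ∷ F) (suc r) = suc (enum F r)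
enum (outside ∷ F) r       = suc (enum F r)

enum-∈ : (F : Subset n) (r : Fin ∣ F ∣) → enum F r ∈ˢ F
enum-∈ (inside  ∷ F) zero    = here
enum-∈ (inside  ∷ F) (suc r) = there (enum-∈ F r)
enum-∈ (outside ∷ F) r       = there (enum-∈ F r)

enum-injective : (F : Subset n) → Injective _≡_ _≡_ (enum F)
enum-injective (inside  ∷ F) {zero}  {zero}  eq = refl
enum-injective (inside  ∷ F) {suc r} {suc t} eq = cong suc (enum-injective F (suc-injective eq))
enum-injective (outside ∷ F) eq = enum-injective F (suc-injective eq)

enum-surjective : {F : Subset n} {x : Fin n} → x ∈ˢ F → ∃[ r ] enum F r ≡ x
enum-surjective {F = inside ∷ F} here = zero , refl
enum-surjective {F = inside ∷ F} (there x∈F) with r , eq ← enum-surjective x∈F = suc r , cong suc eq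
enum-surjective {F = outside ∷ F} (there x∈F) with r , eq ← enum-surjective x∈F = r , cong suc eq

injection⇒≤∣F∣ : {F : Subset n} {f : Fin m → Fin n} → Injective _≡_ _≡_ f → (∀ v → f v ∈ˢ F) → m ≤ ∣ F ∣
injection⇒≤∣F∣ inj f∈F = injective⇒≤ {f = λ v → proj₁ (enum-surjective (f∈F v))} λ {v} {w} eq →
  inj (trans (sym (proj₂ (enum-surjective (f∈F v)))) (trans (cong (enum _) eq) (proj₂ (enum-surjective (f∈F w)))))

-- Systems of private pairs

-- Colourings are not normalised at zero as side-vectors are: contraction renumbers the elements and
-- may remove zero itself, so the induction needs this freedom.
record PrivatePairs (s n : ℕ) : Set where
  field
    colour : Fin s → Fin n → Bool
    a b    : Fin s → Fin n
    cut    : ∀ k → colour k (a k) ≢ colour k (b k)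
    uncut  : ∀ {k k′} → k ≢ k′ → colour k′ (a k) ≡ colour k′ (b k)

-- The quotient map that glues `j` to `i`; `punchIn j` is a section of it.
merge : {i j : Fin (suc n)} → j ≢ i → Fin (suc n) → Fin n
merge {j = j} j≢i x with j ≟ x
... | yes _   = punchOut j≢i
... | no  j≢x = punchOut j≢x

-- Going to the quotient and back moves only `j`, to `i`, which an `f` agreeing on the two cannot
-- notice.
merge-invariant : {i j : Fin (suc n)} (j≢i : j ≢ i) (f : Fin (suc n) → A) → f i ≡ f j →
                  ∀ x → f (punchIn j (merge j≢i x)) ≡ f x
merge-invariant {j = j} j≢i f fi≡fj x with j ≟ x
... | yes refl = trans (cong f (punchIn-punchOut j≢i)) fi≡fj
... | no  j≢x  = cong f (punchIn-punchOut j≢x)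

-- Colouring zero is dropped and its pair is glued. The other colourings leave that pair uncut, so
-- they descend to the quotient.
module Contract (S : PrivatePairs (suc s) (suc n)) where
  open PrivatePairs S

  j : Fin (suc n)
  j = b zero

  j≢i : j ≢ a zero
  j≢i eq = cut zero (cong (colour zero) (sym eq))

  colour-merge : ∀ k x → colour (suc k) (punchIn j (merge j≢i x)) ≡ colour (suc k) x
  colour-merge k = merge-invariant j≢i (colour (suc k)) (uncut 0≢1+n)

  contract : PrivatePairs s n
  contract = record
    { colour = λ k x → colour (suc k) (punchIn j x)
    ; a = merge j≢i ∘ a ∘ suc
    ; b = merge j≢i ∘ b ∘ suc
    ; cut = λ k eq → cut (suc k) (trans (sym (colour-merge k _)) (trans eq (colour-merge k _)))
    ; uncut = λ {_} {k′} k≢k′ → trans (colour-merge k′ _)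
        (trans (uncut (k≢k′ ∘ suc-injective)) (sym (colour-merge k′ _)))
    }

open Contract using (contract)

-- Each contraction uses up one colouring and one element, and a single element leaves nothing to
-- cut.
pairs-bound : PrivatePairs s (suc n) → s ≤ n
pairs-bound {zero}          S = z≤n
pairs-bound {suc s} {zero}  S with PrivatePairs.a S zero | PrivatePairs.b S zero | PrivatePairs.cut S zero
... | zero | zero | cut = contradiction refl cut
pairs-bound {suc s} {suc n} S = s≤s (pairs-bound (contract S))

-- Connectedness of the graph of pairs, phrased through functions instead of paths: `f` descends
-- along each contraction until one element is left. Later arguments apply this to well-chosen
-- Boolean functions.
pairs-connected : (S : PrivatePairs n (suc n)) (f : Fin (suc n) → A) →
                  (∀ k → f (PrivatePairs.a S k) ≡ f (PrivatePairs.b S k)) → ∀ x y → f x ≡ f y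
pairs-connected {zero}  S f const zero zero = refl
pairs-connected {suc n} S f const x y =
  trans (sym (f-merge x)) (trans (pairs-connected (contract S) (f ∘ punchIn j)
    (λ k → trans (f-merge _) (trans (const (suc k)) (sym (f-merge _)))) _ _) (f-merge y))
  where
  open Contract S using (j; j≢i)
  f-merge : ∀ x → f (punchIn j (merge j≢i x)) ≡ f x
  f-merge = merge-invariant j≢i f (const zero)

-- Private edges directed towards the root zero

side : Bipartition m → Fin (suc m) → Bool
side B = lookup (component₀ B)

side-injective : {B C : Bipartition m} → (∀ x → side B x ≡ side C x) → B ≡ C
side-injective eq = lookup-injective (eq ∘ suc)

-- Zero has no coordinate in a `Bipartition`, so position `l` stands for the vertex `suc l`; hence
-- the shift.
side-insertAt : (B : Bipartition m) (l : Fin (suc m)) (c : Bool) (x : Fin (suc m)) →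
                side (insertAtᵛ B l c) (punchIn (suc l) x) ≡ side B x
side-insertAt B l = Vec.insertAt-punchIn (component₀ B) (suc l)

side-removeAt : (B : Bipartition (suc m)) (l : Fin (suc m)) (x : Fin (suc m)) →
                side (removeAtᵛ B l) x ≡ side B (punchIn (suc l) x)
side-removeAt B l x =
  trans (sym (side-insertAt (removeAtᵛ B l) l (lookup B l) x))
        (cong (λ C → side C (punchIn (suc l) x)) (Vec.insertAt-removeAt B l))

-- Private pairs, oriented: the end outside the component of zero cannot be zero, so `child` can
-- take values in `Fin m`.
record PrivateEdges (child : Fin s → Fin m) (parent : Fin s → Fin (suc m)) (B : Fin s → Bipartition m) : Set where
  field
    child-out : ∀ k → side (B k) (suc (child k)) ≡ false
    parent-in : ∀ k → side (B k) (parent k) ≡ true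
    uncut     : ∀ {k k′} → k ≢ k′ → side (B k′) (suc (child k)) ≡ side (B k′) (parent k)

  pairs : PrivatePairs s (suc m)
  pairs = record
    { colour = side ∘ B ; a = suc ∘ child ; b = parent
    ; cut = λ k eq → contradiction (trans (sym (child-out k)) (trans eq (parent-in k))) λ ()
    ; uncut = uncut }

module _ {child : Fin m → Fin m} {parent B} (E : PrivateEdges child parent B) where
  open PrivateEdges E

  connected : (f : Fin (suc m) → A) → (∀ k → f (suc (child k)) ≡ f (parent k)) → ∀ x → f x ≡ f zero
  connected f const x = pairs-connected pairs f const x zero

  -- The intersection of the two components containing zero is left by no edge.
  not-both-below : ∀ {k k′} → k ≢ k′ → side (B k) (suc (child k′)) ≡ false → side (B k′) (suc (child k)) ≢ false
  not-both-below {k} {k′} k≢k′ below above =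
    contradiction (trans (sym (cong (_∧ side (B k′) (suc (child k))) (child-out k)))
                         (connected f const (suc (child k)))) λ ()
    where
    f : Fin (suc _) → Bool
    f x = side (B k) x ∧ side (B k′) x
    const : ∀ h → f (suc (child h)) ≡ f (parent h)
    const h with h ≟ k | h ≟ k′
    ... | yes refl | _ = trans (cong₂ _∧_ (child-out k) above)
      (sym (cong₂ _∧_ (parent-in k) (trans (sym (uncut k≢k′)) above)))
    ... | no _ | yes refl = trans (cong₂ _∧_ below (child-out k′))
      (sym (cong₂ _∧_ (trans (sym (uncut (k≢k′ ∘ sym))) below) (parent-in k′)))
    ... | no h≢k | no h≢k′ = cong₂ _∧_ (uncut h≢k) (uncut h≢k′)

  -- Two edges with the same lower end would lie below each other. As there are as many edges as
  -- nonzero vertices, each such vertex is then the child of exactly one edge.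
  child-injective : Injective _≡_ _≡_ child
  child-injective {k} {k′} eq = decidable-stable (k ≟ k′) λ k≢k′ → not-both-below k≢k′
    (trans (cong (side (B k) ∘ suc) (sym eq)) (child-out k))
    (trans (cong (side (B k′) ∘ suc) eq) (child-out k′))

-- A tree rooted at zero with edges named by their lower ends. The fundamental cuts are stored with
-- the parent map and witness that it has no cycle.
record Tree (m : ℕ) : Set where
  field
    parent : Fin m → Fin (suc m)
    split  : Fin m → Bipartition m
    edges  : PrivateEdges id parent split
  open PrivateEdges edges public

  -- No edge leaves the union of the component of split v with zero and the component of split w without it.
  split-nested : ∀ {v w} → side (split w) (suc v) ≡ false →
                 ∀ {x} → side (split v) x ≡ false → side (split w) x ≡ false
  split-nested {v} {w} v-below-w {x} below-v with v ≟ w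
  ... | yes refl = below-v
  ... | no v≢w = Bool.not-injective
    (trans (sym (cong (_∨ not (side (split w) x)) below-v)) (connected edges f const x))
    where
    f : Fin (suc m) → Bool
    f y = side (split v) y ∨ not (side (split w) y)
    w-above : side (split v) (suc w) ≡ true
    w-above = Bool.¬-not (λ w-below → not-both-below edges v≢w w-below v-below-w)
    const : ∀ h → f (suc h) ≡ f (parent h)
    const h with h ≟ v | h ≟ w
    ... | yes refl | _ = trans (cong₂ (λ p q → p ∨ not q) (child-out v) v-below-w)
      (sym (cong (_∨ not (side (split w) (parent v))) (parent-in v)))
    ... | no _ | yes refl = trans (cong (_∨ _) w-above)
      (sym (cong (_∨ _) (trans (sym (uncut (v≢w ∘ sym))) w-above)))
    ... | no h≢v | no h≢w = cong₂ (λ p q → p ∨ not q) (uncut h≢v) (uncut h≢w)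

  -- The root and a vertex are cut by the split of that vertex. Two nonzero vertices on equal sides
  -- of every split would lie below each other.
  split-separates : ∀ x y → (∀ v → side (split v) x ≡ side (split v) y) → x ≡ y
  split-separates zero    zero    same = refl
  split-separates zero    (suc w) same = contradiction (trans (same w) (child-out w)) λ ()
  split-separates (suc v) zero    same = contradiction (trans (sym (same v)) (child-out v)) λ ()
  split-separates (suc v) (suc w) same = cong suc (decidable-stable (v ≟ w) λ v≢w →
    not-both-below edges v≢w (trans (sym (same v)) (child-out v)) (trans (same w) (child-out w)))

  split-cut⇒≡ : ∀ {v w} → side (split w) (suc v) ≢ side (split w) (parent v) → w ≡ v
  split-cut⇒≡ {v} {w} cut = decidable-stable (w ≟ v) λ w≢v → cut (uncut (w≢v ∘ sym))

  -- A split cuts its own edge, and no other split cuts that edge.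
  split-injective : Injective _≡_ _≡_ split
  split-injective {v} {w} eq = sym (split-cut⇒≡ λ same → contradiction
    (trans (sym (child-out v)) (trans (cong (flip side (suc v)) eq)
      (trans same (trans (cong (flip side (parent v)) (sym eq)) (parent-in v))))) λ ())

  parent-≢ : ∀ v → parent v ≢ suc v
  parent-≢ v eq = contradiction
    (trans (sym (parent-in v)) (trans (cong (side (split v)) eq) (child-out v))) λ ()

open Tree

-- Both sides flip along the edge of `w` and along no other edge, so their xor is constant on the
-- tree; at the root it is false.
split-determined : (T T′ : Tree m) → parent T ≗ parent T′ → split T ≗ split T′
split-determined {m} T T′ parent-eq w = side-injective λ x → xor≡false _ _ (connected (edges T) f const x)
  where
  xor≡false : ∀ p q → p xor q ≡ false → p ≡ q
  xor≡false false q eq = sym eq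
  xor≡false true  q eq = sym (Bool.not-injective eq)
  f : Fin (suc m) → Bool
  f y = side (split T w) y xor side (split T′ w) y
  const : ∀ h → f (suc h) ≡ f (parent T h)
  const h with h ≟ w
  ... | yes refl = trans (cong₂ _xor_ (child-out T w) (child-out T′ w))
    (sym (cong₂ _xor_ (parent-in T w) (trans (cong (side (split T′ w)) (parent-eq w)) (parent-in T′ w))))
  ... | no h≢w = cong₂ _xor_ (uncut T h≢w)
    (trans (uncut T′ h≢w) (cong (side (split T′ w)) (sym (parent-eq h))))

-- The split of v is the smallest one having v outside, so it is determined by the set of all splits.
splits-determine-split : (T T′ : Tree m) → (∀ v → ∃[ u ] split T v ≡ split T′ u) →
                         (∀ v → ∃[ u ] split T′ v ≡ split T u) → split T ≗ split T′
splits-determine-split T T′ T⊆T′ T′⊆T v =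
  side-injective λ x → same (below T T′ T′⊆T x) (below T′ T T⊆T′ x)
  where
  below : (T T′ : Tree _) → (∀ v → ∃[ u ] split T′ v ≡ split T u) →
          ∀ x → side (split T v) x ≡ false → side (split T′ v) x ≡ false
  below T T′ T′⊆T x x-below with u , eq ← T′⊆T v =
    trans (cong (flip side x) eq)
      (split-nested T {v} {u} (trans (cong (flip side (suc v)) (sym eq)) (child-out T′ v)) {x} x-below)
  same : ∀ {p q} → (p ≡ false → q ≡ false) → (q ≡ false → p ≡ false) → p ≡ q
  same {false} {q}     to from = sym (to refl)
  same {true}  {false} to from = from refl
  same {true}  {true}  to from = refl

-- The parent of `v` has every side forced: inside for the split of `v`, and the side of `v` for all
-- others. Splits separate, so this pins it down.
split-determines-parent : (T T′ : Tree m) → split T ≗ split T′ → parent T ≗ parent T′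
split-determines-parent T T′ split-eq v = split-separates T _ _ same
  where
  same : ∀ w → side (split T w) (parent T v) ≡ side (split T w) (parent T′ v)
  same w with v ≟ w
  ... | yes refl = trans (parent-in T v)
    (sym (trans (cong (flip side (parent T′ v)) (split-eq v)) (parent-in T′ v)))
  ... | no v≢w = trans (sym (uncut T v≢w)) (trans (cong (flip side (suc v)) (split-eq w))
    (trans (uncut T′ v≢w) (cong (flip side (parent T′ v)) (sym (split-eq w)))))

-- With `s ≡ m` the injection `child` is a bijection, so edges can be renamed by their children
-- without changing the set of bipartitions.
edges⇒tree : {child : Fin s → Fin m} {parent : Fin s → Fin (suc m)} {B : Fin s → Bipartition m} →
             s ≡ m → PrivateEdges child parent B →
             ∃[ T ] ((∀ v → ∃[ k ] split T v ≡ B k) × (∀ k → ∃[ v ] B k ≡ split T v))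
edges⇒tree {child = child} {parent} {B} refl E =
  record { parent = parent ∘ edge ; split = B ∘ edge ; edges = record
    { child-out = λ v → trans (cong (side (B (edge v)) ∘ suc) (sym (child-edge v))) (E.child-out (edge v))
    ; parent-in = E.parent-in ∘ edge
    ; uncut = λ {v} {w} v≢w → trans (cong (side (B (edge w)) ∘ suc) (sym (child-edge v)))
        (E.uncut λ eq → v≢w (trans (sym (child-edge v)) (trans (cong child eq) (child-edge w)))) } }
  , (λ v → edge v , refl)
  , (λ k → child k , cong B (sym (child-injective E (child-edge (child k)))))
  where
  module E = PrivateEdges E
  edge : Fin _ → Fin _
  edge v = proj₁ (injective⇒surjective (child-injective E) v)
  child-edge : ∀ v → child (edge v) ≡ v
  child-edge v = proj₂ (injective⇒surjective (child-injective E) v)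

-- Attaching and removing leaves

private
  leafSplit : Fin (suc m) → Bipartition (suc m)
  leafSplit l = insertAtᵛ (replicate _ true) l false

  leafSplit-else : (l : Fin (suc m)) (x : Fin (suc m)) → side (leafSplit l) (punchIn (suc l) x) ≡ true
  leafSplit-else l x = trans (side-insertAt (replicate _ true) l false x) (Vec.lookup-replicate x true)

-- Hangs a new leaf `suc l` on the old vertex `x`, renumbering the old vertices around it. Old
-- splits put the leaf on the side of `x`, so only its own split cuts the new edge.
graft : Tree m → Fin (suc m) → Fin (suc m) → Tree (suc m)
graft {m} T l x = record { parent = parent′ ; split = split′ ; edges = record
  { child-out = punchIn-cover l
      (trans (cong (flip side (suc l)) split-l) (Vec.insertAt-lookup (replicate _ true) l false))
      (λ v → trans (cong (flip side (punchIn (suc l) (suc v))) (split-in v)) (trans (grow-else v (suc v)) (child-out T v)))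
  ; parent-in = punchIn-cover l
      (trans (cong₂ side split-l parent-l) (leafSplit-else l x))
      (λ v → trans (cong₂ side (split-in v) (parent-in′ v)) (trans (grow-else v (parent T v)) (parent-in T v)))
  ; uncut = λ {k} {k′} → uncut′ k k′ } }
  where
  grow : Bipartition m → Bipartition (suc m)
  grow B = insertAtᵛ B l (side B x)
  grow-else : ∀ v y → side (grow (split T v)) (punchIn (suc l) y) ≡ side (split T v) y
  grow-else v = side-insertAt (split T v) l _
  parent′ : Fin (suc m) → Fin (suc (suc m))
  parent′ = insertAt (punchIn (suc l) ∘ parent T) l (punchIn (suc l) x)
  split′ : Fin (suc m) → Bipartition (suc m)
  split′ = insertAt (grow ∘ split T) l (leafSplit l)
  parent-l : parent′ l ≡ punchIn (suc l) x
  parent-l = insertAt-lookup (punchIn (suc l) ∘ parent T) l _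
  parent-in′ : ∀ v → parent′ (punchIn l v) ≡ punchIn (suc l) (parent T v)
  parent-in′ = insertAt-punchIn (punchIn (suc l) ∘ parent T) l _
  split-l : split′ l ≡ leafSplit l
  split-l = insertAt-lookup (grow ∘ split T) l _
  split-in : ∀ v → split′ (punchIn l v) ≡ grow (split T v)
  split-in = insertAt-punchIn (grow ∘ split T) l _
  uncut′ : ∀ k k′ → k ≢ k′ → side (split′ k′) (suc k) ≡ side (split′ k′) (parent′ k)
  uncut′ = punchIn-cover l
    (punchIn-cover l (λ l≢l → contradiction refl l≢l)
      (λ w _ → trans (cong (flip side (suc l)) (split-in w)) (trans (Vec.insertAt-lookup (split T w) l _)
        (sym (trans (cong₂ side (split-in w) parent-l) (grow-else w x))))))
    (λ v → punchIn-cover l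
      (λ _ → trans (cong (flip side (punchIn (suc l) (suc v))) split-l) (trans (leafSplit-else l (suc v))
        (sym (trans (cong₂ side split-l (parent-in′ v)) (leafSplit-else l (parent T v))))))
      (λ w v≢w → trans (cong (flip side (punchIn (suc l) (suc v))) (split-in w)) (trans (grow-else w (suc v))
        (trans (uncut T (v≢w ∘ cong (punchIn l)))
        (sym (trans (cong₂ side (split-in w) (parent-in′ v)) (grow-else w (parent T v))))))))

-- Missing labels and smallest leaves

data Hit (h : Fin k → Fin (suc n)) (l : Fin n) : Set where
  hit : ∀ i → h i ≡ suc l → Hit h l

Hit? : (h : Fin k → Fin (suc n)) (l : Fin n) → Dec (Hit h l)
Hit? h l = map′ (λ (i , eq) → hit i eq) (λ { (hit i eq) → i , eq }) (any? (λ i → h i ≟ suc l))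

-- The inverse of grafting: a vertex without children is never a parent, so parents and splits
-- restrict to the remaining vertices.
prune : (T : Tree (suc m)) (l : Fin (suc m)) → ¬ Hit (parent T) l →
        ∃[ T′ ] (∀ v → punchIn (suc l) (parent T′ v) ≡ parent T (punchIn l v))
prune {m} T l l-leaf = record { parent = parent′ ; split = split′ ; edges = record
  { child-out = λ v → trans (side-removeAt (split T (punchIn l v)) l (suc v)) (child-out T (punchIn l v))
  ; parent-in = λ v → trans (side-parent v v) (parent-in T (punchIn l v))
  ; uncut = λ {v} {w} v≢w → trans (side-removeAt (split T (punchIn l w)) l (suc v))
      (trans (uncut T (v≢w ∘ punchIn-injective l v w)) (sym (side-parent w v))) } }
  , parent-lift
  where
  parent′ : Fin m → Fin (suc m)
  parent′ v = punchOut {i = suc l} (λ eq → l-leaf (hit (punchIn l v) (sym eq)))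
  split′ : Fin m → Bipartition m
  split′ v = removeAtᵛ (split T (punchIn l v)) l
  parent-lift : ∀ v → punchIn (suc l) (parent′ v) ≡ parent T (punchIn l v)
  parent-lift v = punchIn-punchOut _
  side-parent : ∀ w v → side (split′ w) (parent′ v) ≡ side (split T (punchIn l w)) (parent T (punchIn l v))
  side-parent w v = trans (side-removeAt (split T (punchIn l w)) l (parent′ v))
    (cong (side (split T (punchIn l w))) (parent-lift v))

-- Minimality makes the leaf canonical, as the Prüfer rule requires. The same notion serves parent
-- maps (no child) and codes (absent label); the root is never a leaf.
Leaf : (Fin k → Fin (suc n)) → Fin n → Set
Leaf h l = ¬ Hit h l × (∀ j → j < l → Hit h j)

leaf-exists : (h : Fin k → Fin (suc n)) → ¬ (∀ l → Hit h l) → ∃ (Leaf h)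
leaf-exists {n = n} h ¬all with l , ¬hit , below ← ¬∀⟶∃¬-smallest n (Hit h) (Hit? h) ¬all =
  l , ¬hit , λ j j<l → subst (Hit h)
    (toℕ-injective (trans (toℕ-inject (fromℕ< j<l)) (toℕ-fromℕ< j<l))) (below (fromℕ< j<l))

-- The smallest missing label depends only on the set of values, so a code and a parent map with the
-- same nonzero values agree on it.
leaf-unique : {h : Fin k → Fin (suc n)} {h′ : Fin s → Fin (suc n)} →
              (∀ {l} → Hit h l → Hit h′ l) → (∀ {l} → Hit h′ l → Hit h l) →
              ∀ {l l′} → Leaf h l → Leaf h′ l′ → l ≡ l′
leaf-unique to from {l} {l′} (miss , below) (miss′ , below′) with <-cmp l l′
... | tri< l<l′ _ _ = contradiction (from (below′ l l<l′)) miss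
... | tri≈ _ eq _   = eq
... | tri> _ _ l′<l = contradiction (to (below l′ l′<l)) miss′

index : {h : Fin k → Fin (suc n)} {l : Fin n} → Hit h l → Fin k
index (hit i _) = i

at-index : {h : Fin k → Fin (suc n)} {l : Fin n} (p : Hit h l) → h (index p) ≡ suc l
at-index (hit _ eq) = eq

index-injective : {h : Fin k → Fin (suc n)} (all : ∀ l → Hit h l) → Injective _≡_ _≡_ (λ l → index (all l))
index-injective {h = h} all {l} {j} eq =
  suc-injective (trans (sym (at-index (all l))) (trans (cong h eq) (at-index (all j))))

-- Distinct labels are hit at distinct positions, so `k` positions cannot reach all `n` nonzero
-- labels.
few-values⇒leaf : k <ℕ n → (h : Fin k → Fin (suc n)) → ∃ (Leaf h)
few-values⇒leaf k<n h = leaf-exists h λ all → <⇒≱ k<n (injective⇒≤ (index-injective all))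

-- If every vertex had a child, no vertex would be left to be a child of the root.
tree-leaf : (T : Tree (suc m)) → ∃ (Leaf (parent T))
tree-leaf {m} T = leaf-exists (parent T) λ all → contradiction
  (connected (edges T) isZero (λ v → sym (parent-nonzero all v)) (suc zero)) λ ()
  where
  isZero : Fin n → Bool
  isZero zero    = true
  isZero (suc _) = false
  parent-nonzero : (∀ l → Hit (parent T) l) → ∀ v → isZero (parent T v) ≡ false
  parent-nonzero all v with l , refl ← injective⇒surjective (index-injective all) v =
    cong isZero (at-index (all l))

Hit-cong : {h h′ : Fin k → Fin (suc n)} → h ≗ h′ → ∀ {l} → Hit h l → Hit h′ l
Hit-cong eq (hit i hi≡) = hit i (trans (sym (eq i)) hi≡)

-- A code grows at its head, a parent map at the position of the new leaf; either way the set of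
-- values gains just `x`.
Hit-∷ : {xs : Vec (Fin (suc n)) k} (h : Fin s → Fin (suc n)) (l₀ : Fin (suc s)) {x : Fin (suc n)} →
        (∀ {l} → Hit (lookup xs) l → Hit h l) → ∀ {l} → Hit (lookup (x ∷ xs)) l → Hit (insertAt h l₀ x) l
Hit-∷ h l₀ to (hit zero eq) = hit l₀ (trans (insertAt-lookup h l₀ _) eq)
Hit-∷ h l₀ to (hit (suc i) eq) with hit v eq′ ← to (hit i eq) =
  hit (punchIn l₀ v) (trans (insertAt-punchIn h l₀ _ v) eq′)

Hit-∷⁻ : {xs : Vec (Fin (suc n)) k} (h : Fin s → Fin (suc n)) (l₀ : Fin (suc s)) {x : Fin (suc n)} →
         (∀ {l} → Hit h l → Hit (lookup xs) l) → ∀ {l} → Hit (insertAt h l₀ x) l → Hit (lookup (x ∷ xs)) l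
Hit-∷⁻ {xs = xs} h l₀ {x} from {l} (hit v eq) = punchIn-cover
  {P = λ v → insertAt h l₀ x v ≡ suc l → Hit (lookup (x ∷ xs)) l} l₀
  (λ eq → hit zero (trans (sym (insertAt-lookup h l₀ _)) eq))
  (λ v eq → later (from (hit v (trans (sym (insertAt-punchIn h l₀ _ v)) eq))))
  v eq
  where
  later : Hit (lookup xs) l → Hit (lookup (x ∷ xs)) l
  later (hit i eq) = hit (suc i) eq

Hit-punchIn : {g : Fin k → Fin (suc n)} {h : Fin s → Fin (suc n)} {l₀ : Fin (suc n)} →
              (∀ {l} → Hit g l → Hit h l) → ∀ {l} → Hit (punchIn (suc l₀) ∘ g) l → Hit (punchIn (suc l₀) ∘ h) l
Hit-punchIn {g = g} to (hit i eq) with g i in gi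
-- Relabelling past a nonzero label fixes the root.
... | zero  = contradiction eq λ ()
... | suc j with hit v eq′ ← to (hit i gi) = hit v (trans (cong (punchIn _) eq′) eq)

-- Prüfer codes

relabel : (z : Fin (suc n)) (xs : Vec (Fin (suc n)) k) → (∀ i → z ≢ lookup xs i) →
          ∃[ ys ] map (punchIn z) ys ≡ xs
relabel z []       avoid = [] , refl
relabel z (x ∷ xs) avoid with ys , eq ← relabel z xs (avoid ∘ suc) =
  punchOut (avoid zero) ∷ ys , cong₂ _∷_ (punchIn-punchOut (avoid zero)) eq

map-punchIn-injective : (z : Fin (suc n)) {xs ys : Vec (Fin n) k} →
                        map (punchIn z) xs ≡ map (punchIn z) ys → xs ≡ ys
map-punchIn-injective z {[]}     {[]}     eq = refl
map-punchIn-injective z {x ∷ xs} {y ∷ ys} eq with x-eq , xs-eq ← Vec.∷-injective eq =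
  cong₂ _∷_ (punchIn-injective z x y x-eq) (map-punchIn-injective z xs-eq)

-- The sequence of parents of the removed leaves has `m` entries for `m` at least one, the last
-- always the root; that entry is left out.
Code : ℕ → Set
Code m = Vec (Fin (suc m)) (m ∸ 1)

-- One step of decoding: l is the smallest vertex other than the root absent from
-- the code; it becomes a child of the head, and rest is relabelled to avoid l.
record Step (c : Code (suc (suc m))) : Set where
  constructor step
  field
    l      : Fin (suc (suc m))
    leaf   : Leaf (lookup c) l
    x      : Fin (suc (suc m))
    rest   : Code (suc m)
    unstep : map (punchIn (suc l)) (x ∷ rest) ≡ c

opaque
  -- A code is one entry shorter than the list of nonzero labels, so some such label is absent and
  -- the code can be renumbered around it.
  firstStep : (c : Code (suc (suc m))) → Step c
  firstStep c with l , leaf@(miss , _) ← few-values⇒leaf ≤-refl (lookup c)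
              with x ∷ rest , eq ← relabel (suc l) c (λ i eq → miss (hit i (sym eq))) =
    step l leaf x rest eq

decode : ∀ m → Code m → Tree m
decode zero          c = record { parent = λ () ; split = λ () ; edges = record
  { child-out = λ () ; parent-in = λ () ; uncut = λ { {()} } } }
-- The omitted last entry: the remaining vertex hangs on the root.
decode (suc zero)    c = graft (decode zero []) zero zero
decode (suc (suc m)) c = graft (decode (suc m) rest) l x
  where
  open Step (firstStep c)

-- With its converse below: the nonzero labels in a code are the nonzero vertices that have
-- children. Hence the smallest absent label is the smallest leaf of the decoded tree.
decode-hit : ∀ m (c : Code m) {l} → Hit (lookup c) l → Hit (parent (decode m c)) l
decode-hit (suc zero)    [] (hit () _)
decode-hit (suc (suc m)) c  p =
  Hit-∷ {xs = map (punchIn (suc l)) rest} (punchIn (suc l) ∘ parent (decode (suc m) rest)) l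
    (Hit-punchIn (decode-hit (suc m) rest) ∘ Hit-cong (λ i → Vec.lookup-map i _ rest))
    (subst (λ c → Hit (lookup c) _) (sym unstep) p)
  where
  open Step (firstStep c)

decode-hit⁻ : ∀ m (c : Code m) {l} → Hit (parent (decode m c)) l → Hit (lookup c) l
decode-hit⁻ (suc zero)    [] (hit zero ())
decode-hit⁻ (suc (suc m)) c  p = subst (λ c → Hit (lookup c) _) unstep
  (Hit-∷⁻ {xs = map (punchIn (suc l)) rest} (punchIn (suc l) ∘ parent (decode (suc m) rest)) l
    (Hit-cong (λ i → sym (Vec.lookup-map i _ rest)) ∘ Hit-punchIn (decode-hit⁻ (suc m) rest)) p)
  where
  open Step (firstStep c)

insertAt-injective : {g h : Fin n → A} (l : Fin (suc n)) {x y : A} →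
                     insertAt g l x ≗ insertAt h l y → x ≡ y × g ≗ h
insertAt-injective {g = g} {h} l eq =
  trans (sym (insertAt-lookup g l _)) (trans (eq l) (insertAt-lookup h l _)) ,
  λ v → trans (sym (insertAt-punchIn g l _ v)) (trans (eq (punchIn l v)) (insertAt-punchIn h l _ v))

insertAt-cong : {g : Fin n → A} (h : Fin (suc n) → A) (l : Fin (suc n)) {x : A} →
                x ≡ h l → (∀ v → g v ≡ h (punchIn l v)) → insertAt g l x ≗ h
insertAt-cong {g = g} h l x-eq g-eq = punchIn-cover l
  (trans (insertAt-lookup g l _) x-eq) (λ v → trans (insertAt-punchIn g l _ v) (g-eq v))

decodeStep : {c : Code (suc (suc m))} → Step c → Tree (suc (suc m))
decodeStep (step l _ x rest _) = graft (decode _ rest) l x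

-- Stated for arbitrary steps so that the equality of the two leaves can be eliminated. The parent
-- map then yields the head at `l` and the decoded rest elsewhere.
same-step : {c d : Code (suc (suc m))} (S : Step c) (S′ : Step d) →
            (∀ c d → parent (decode (suc m) c) ≗ parent (decode (suc m) d) → c ≡ d) →
            parent (decodeStep S) ≗ parent (decodeStep S′) → Step.l S ≡ Step.l S′ → c ≡ d
same-step (step l _ x rest unstep) (step .l _ x′ rest′ unstep′) rest-injective eq refl =
  let x-eq , rest-eq = insertAt-injective l eq
  in trans (sym unstep) (trans (cong₂ (λ y ys → y ∷ map (punchIn (suc l)) ys) x-eq
       (rest-injective rest rest′ (λ v → punchIn-injective (suc l) _ _ (rest-eq v)))) unstep′)

-- Equal parent maps give codes with the same nonzero labels, hence the same first leaf.
decode-injective : ∀ m (c d : Code m) → parent (decode m c) ≗ parent (decode m d) → c ≡ d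
decode-injective zero          [] [] eq = refl
decode-injective (suc zero)    [] [] eq = refl
decode-injective (suc (suc m)) c  d  eq = same-step (firstStep c) (firstStep d) (decode-injective (suc m)) eq
  (leaf-unique (decode-hit⁻ _ d ∘ Hit-cong eq ∘ decode-hit _ c)
               (decode-hit⁻ _ c ∘ Hit-cong (sym ∘ eq) ∘ decode-hit _ d)
               (Step.leaf (firstStep c)) (Step.leaf (firstStep d)))

-- Decoding inverts pruning: the extended code has the same nonzero values as the parent map of `T`,
-- so its first step picks the same leaf `l`.
decode-graft : (T : Tree (suc (suc m))) (T′ : Tree (suc m)) (l : Fin (suc (suc m))) → Leaf (parent T) l →
               (∀ v → punchIn (suc l) (parent T′ v) ≡ parent T (punchIn l v)) →
               (c′ : Code (suc m)) → parent (decode (suc m) c′) ≗ parent T′ →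
               ∃[ c ] parent (decode (suc (suc m)) c) ≗ parent T
decode-graft {m} T T′ l leaf T′-lift c′ c′-eq = c , decoded (firstStep c) (leaf-unique T⇒c c⇒T leaf (Step.leaf (firstStep c)))
  where
  c : Code (suc (suc m))
  -- The parent of the pruned leaf, then the code of the pruned tree renumbered around `l`.
  c = parent T l ∷ map (punchIn (suc l)) c′
  parent-insert : insertAt (punchIn (suc l) ∘ parent T′) l (parent T l) ≗ parent T
  parent-insert = insertAt-cong (parent T) l refl T′-lift
  c⇒T : ∀ {j} → Hit (lookup c) j → Hit (parent T) j
  c⇒T = Hit-cong parent-insert ∘ Hit-∷ {xs = map (punchIn (suc l)) c′} (punchIn (suc l) ∘ parent T′) l
    (Hit-punchIn (Hit-cong c′-eq ∘ decode-hit (suc m) c′) ∘ Hit-cong (λ i → Vec.lookup-map i _ c′))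
  T⇒c : ∀ {j} → Hit (parent T) j → Hit (lookup c) j
  T⇒c = Hit-∷⁻ (punchIn (suc l) ∘ parent T′) l
    (Hit-cong (λ i → sym (Vec.lookup-map i _ c′)) ∘ Hit-punchIn (decode-hit⁻ (suc m) c′ ∘ Hit-cong (sym ∘ c′-eq)))
    ∘ Hit-cong (sym ∘ parent-insert)
  decoded : (S : Step c) → l ≡ Step.l S → parent (decodeStep S) ≗ parent T
  decoded (step .l _ x rest unstep) refl = insertAt-cong (parent T) l (cong head unstep)
    (λ v → trans (cong (λ c → punchIn (suc l) (parent (decode (suc m) c) v)) (map-punchIn-injective (suc l) (cong tail unstep)))
      (trans (cong (punchIn (suc l)) (c′-eq v)) (T′-lift v)))

decode-surjective : ∀ m (T : Tree m) → ∃[ c ] parent (decode m c) ≗ parent T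
decode-surjective zero          T = [] , λ ()
decode-surjective (suc zero)    T = [] , λ { zero → sym (only-zero (parent T zero) (parent-≢ T zero)) }
  where
  only-zero : (x : Fin 2) → x ≢ suc zero → x ≡ zero
  only-zero zero       x≢1 = refl
  only-zero (suc zero) x≢1 = contradiction refl x≢1
decode-surjective (suc (suc m)) T =
  let l , leaf = tree-leaf T
      T′ , T′-lift = prune T l (proj₁ leaf)
      c′ , c′-eq = decode-surjective (suc m) T′
  in decode-graft T T′ l leaf T′-lift c′ c′-eq

-- Families of bipartitions

bip-surjective : (B : Bipartition m) → ∃[ k ] bip m k ≡ B
bip-surjective {zero}  [] = zero , refl
bip-surjective {suc m} (outside ∷ B) with a , eq ← bip-surjective B = a ↑ˡ _ , bip-left
  where
  bip-left : bip (suc m) (a ↑ˡ _) ≡ outside ∷ B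
  bip-left rewrite splitAt-↑ˡ (2 ^ m) a (2 ^ m + 0) = cong (outside ∷_) eq
bip-surjective {suc m} (inside ∷ B) with b , eq ← bip-surjective B = 2 ^ m ↑ʳ b′ , bip-right
  where
  -- `2 ^ suc m` unfolds to `2 ^ m + (2 ^ m + 0)`; the cast removes the trailing zero.
  b′ : Fin (2 ^ m + 0)
  b′ = cast (sym (+-identityʳ (2 ^ m))) b
  bip-right : bip (suc m) (2 ^ m ↑ʳ b′) ≡ inside ∷ B
  bip-right rewrite splitAt-↑ʳ (2 ^ m) (2 ^ m + 0) b′ =
    cong (inside ∷_) (trans (cong (bip m) (cast-involutive (+-identityʳ (2 ^ m)) _ b)) eq)

bip-injective : ∀ m → Injective _≡_ _≡_ (bip m)
bip-injective zero    {zero} {zero} eq = refl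
bip-injective (suc m) {k} {k′} eq with splitAt (2 ^ m) k in k-eq | splitAt (2 ^ m) k′ in k′-eq
... | inj₁ a | inj₁ a′ = trans (sym (splitAt⁻¹-↑ˡ k-eq))
  (trans (cong (_↑ˡ _) (bip-injective m (Vec.∷-injectiveʳ eq))) (splitAt⁻¹-↑ˡ k′-eq))
... | inj₁ a | inj₂ b′ = contradiction (Vec.∷-injectiveˡ eq) λ ()
... | inj₂ b | inj₁ a′ = contradiction (Vec.∷-injectiveˡ eq) λ ()
... | inj₂ b | inj₂ b′ = trans (sym (splitAt⁻¹-↑ʳ k-eq)) (trans (cong (2 ^ m ↑ʳ_) b≡b′) (splitAt⁻¹-↑ʳ k′-eq))
  where
  b≡b′ : b ≡ b′
  b≡b′ = trans (sym (cast-involutive (sym (+-identityʳ (2 ^ m))) (+-identityʳ (2 ^ m)) b))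
    (trans (cong (cast _) (bip-injective m (Vec.∷-injectiveʳ eq)))
      (cast-involutive (sym (+-identityʳ (2 ^ m))) (+-identityʳ (2 ^ m)) b′))

familyOf : (Fin s → Bipartition m) → Family m
familyOf {m = m} B = tabulate λ k → does (any? λ v → Vec.≡-dec Bool._≟_ (bip m k) (B v))

∈-familyOf⁺ : {B : Fin s → Bipartition m} {k : Fin (2 ^ m)} → ∃[ v ] bip m k ≡ B v → k ∈ˢ familyOf B
∈-familyOf⁺ {k = k} k-in = Vec.lookup⇒[]= k _ (trans (Vec.lookup∘tabulate _ k) (dec-true (any? _) k-in))

∈-familyOf⁻ : {B : Fin s → Bipartition m} {k : Fin (2 ^ m)} → k ∈ˢ familyOf B → ∃[ v ] bip m k ≡ B v
∈-familyOf⁻ {m = m} {B = B} {k} k∈ with any? (λ v → Vec.≡-dec Bool._≟_ (bip m k) (B v))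
                                     | trans (sym (Vec.lookup∘tabulate _ k)) (Vec.[]=⇒lookup k∈)
... | yes k-in | _ = k-in

Cuts? : (B : Bipartition m) (i j : Fin (suc m)) → Dec (Cuts B i j)
Cuts? B i j = ¬? (side B i Bool.≟ side B j)

-- Private edges of a minimal separating family

PrivateEdge : (F : Family m) → Fin (2 ^ m) → Fin m → Fin (suc m) → Set
PrivateEdge {m} F k v u = side (bip m k) (suc v) ≡ false × side (bip m k) u ≡ true ×
  (∀ {k′} → k′ ∈ˢ F → k ≢ k′ → side (bip m k′) (suc v) ≡ side (bip m k′) u)

-- Without `k` the family no longer separates, and finite search turns this failure into a concrete
-- pair. The whole family cuts that pair, so `k` must.
private-pair : {F : Family m} {k : Fin (2 ^ m)} → MinimalSeparating {m} F → k ∈ˢ F →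
               ∃₂ λ i j → Cuts (bip m k) i j × (∀ {k′} → k′ ∈ˢ F → k ≢ k′ → side (bip m k′) i ≡ side (bip m k′) j)
private-pair {m} {F} {k} (separating , minimal) k∈F =
  let i , ¬i = ¬∀⟶∃¬ _ (λ i → ∀ j → Separated i j) (λ i → all? (Separated? i)) (minimal (F - k) (x∈p⇒p-x⊂p k∈F))
      j , ¬ij = ¬∀⟶∃¬ _ (Separated i) (Separated? i) ¬i
  in i , j , k-cuts i j ¬ij , λ {k′} → others-do-not i j ¬ij {k′}
  where
  Separated : Fin (suc m) → Fin (suc m) → Set
  Separated i j = i ≢ j → ∃[ k′ ] (k′ ∈ˢ F - k × Cuts (bip m k′) i j)
  Separated? : ∀ i j → Dec (Separated i j)
  Separated? i j = ¬? (i ≟ j) →-dec any? λ k′ → (k′ ∈? F - k) ×-dec Cuts? (bip m k′) i j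
  others-do-not : ∀ i j → ¬ Separated i j → ∀ {k′} → k′ ∈ˢ F → k ≢ k′ → side (bip m k′) i ≡ side (bip m k′) j
  others-do-not i j ¬ij {k′} k′∈F k≢k′ = decidable-stable (_ Bool.≟ _) λ cut →
    ¬ij λ _ → k′ , x∈p∧x≢y⇒x∈p-y k′∈F (k≢k′ ∘ sym) , cut
  k-cuts : ∀ i j → ¬ Separated i j → Cuts (bip m k) i j
  -- For equal `i` and `j`, `Separated i j` would hold vacuously.
  k-cuts i j ¬ij same with separating i j (λ i≡j → ¬ij (contradiction i≡j))
  ... | k′ , k′∈F , cut with k ≟ k′
  ...   | yes refl = cut same
  ...   | no k≢k′  = cut (others-do-not i j ¬ij k′∈F k≢k′)

private-edge : {F : Family m} {k : Fin (2 ^ m)} → MinimalSeparating {m} F → k ∈ˢ F → ∃₂ (PrivateEdge F k)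
private-edge {m} {F} {k} min k∈F = let i , j , cut , uncut = private-pair {m} {F} min k∈F in orient i j cut uncut
  where
  orient : ∀ i j → Cuts (bip m k) i j →
           (∀ {k′} → k′ ∈ˢ F → k ≢ k′ → side (bip m k′) i ≡ side (bip m k′) j) → ∃₂ (PrivateEdge F k)
  orient i j cut uncut with side (bip m k) i in i-side | side (bip m k) j in j-side
  -- The end on the false side is a successor because zero always lies inside.
  orient (suc v) j cut uncut | false | true  = v , j , i-side , j-side , uncut
  orient i (suc v) cut uncut | true  | false = v , i , j-side , i-side , λ k′∈F k≢k′ → sym (uncut k′∈F k≢k′)
  orient i j cut uncut | false | false = contradiction refl cut
  orient i j cut uncut | true  | true  = contradiction refl cut

minimal⇒edges : {F : Family m} → MinimalSeparating {m} F →
                ∃₂ λ child parent → PrivateEdges child parent (bip m ∘ enum F)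
minimal⇒edges {m} {F} min = proj₁ ∘ edge , (λ r → proj₁ (proj₂ (edge r))) , record
  { child-out = λ r → proj₁ (proj₂ (proj₂ (edge r)))
  ; parent-in = λ r → proj₁ (proj₂ (proj₂ (proj₂ (edge r))))
  ; uncut = λ {r} {r′} r≢r′ → proj₂ (proj₂ (proj₂ (proj₂ (edge r)))) (enum-∈ F r′) (r≢r′ ∘ enum-injective F) }
  where
  edge : ∀ r → ∃₂ (PrivateEdge F (enum F r))
  edge r = private-edge {m} {F} min (enum-∈ F r)

minimal⇒size≤ : {F : Family m} → MinimalSeparating {m} F → size {m} F ≤ m
minimal⇒size≤ {m} {F} min = pairs-bound (PrivateEdges.pairs (proj₂ (proj₂ (minimal⇒edges {m} {F} min))))

-- Fundamental cuts as maximum minimal families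

cuts : Tree m → Family m
cuts T = familyOf (split T)

-- Dropping the split of `v` leaves `v` and its parent unseparated, since no other split cuts their
-- edge.
cuts-minimal : (T : Tree m) → MinimalSeparating {m} (cuts T)
cuts-minimal {m} T = separating , minimal
  where
  separating : Separating {m} (cuts T)
  separating i j i≢j =
    let v , cut = ¬∀⟶∃¬ m (λ v → side (split T v) i ≡ side (split T v) j) (λ v → _ Bool.≟ _)
                    (i≢j ∘ split-separates T i j)
        k , eq  = bip-surjective (split T v)
    in k , ∈-familyOf⁺ (v , eq) , subst (λ B → Cuts B i j) (sym eq) cut
  minimal : ∀ G → G ⊂ cuts T → ¬ Separating {m} G
  minimal G (G⊆ , k , k∈ , k∉G) G-separating with v , k-eq ← ∈-familyOf⁻ {B = split T} k∈
    with k′ , k′∈G , cut ← G-separating (suc v) (parent T v) (parent-≢ T v ∘ sym)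
    with w , k′-eq ← ∈-familyOf⁻ {B = split T} (G⊆ k′∈G)
    with refl ← split-cut⇒≡ T {v} {w} (subst (λ B → Cuts B (suc v) (parent T v)) k′-eq cut) =
    k∉G (subst (_∈ˢ G) (bip-injective m (trans k′-eq (sym k-eq))) k′∈G)

cuts-size : (T : Tree m) → m ≤ size {m} (cuts T)
cuts-size {m} T = injection⇒≤∣F∣ {f = λ v → proj₁ (bip-surjective (split T v))}
  (λ {v} {w} eq → split-injective T (trans (sym (proj₂ (bip-surjective (split T v))))
    (trans (cong (bip m) eq) (proj₂ (bip-surjective (split T w))))))
  (λ v → ∈-familyOf⁺ (v , proj₂ (bip-surjective (split T v))))

cuts-maximum : (T : Tree m) → MaxMinimalSeparating {m} (cuts T)
cuts-maximum {m} T = cuts-minimal T , λ G G-min → ≤-trans (minimal⇒size≤ {m} {G} G-min) (cuts-size T)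

cuts≡⇒⊆ : (T T′ : Tree m) → cuts T ≡ cuts T′ → ∀ v → ∃[ u ] split T v ≡ split T′ u
cuts≡⇒⊆ T T′ eq v with k , k-eq ← bip-surjective (split T v)
  with u , k-eq′ ← ∈-familyOf⁻ {B = split T′} (subst (k ∈ˢ_) eq (∈-familyOf⁺ (v , k-eq))) =
  u , trans (sym k-eq) k-eq′

cuts-injective : (T T′ : Tree m) → cuts T ≡ cuts T′ → parent T ≗ parent T′
cuts-injective T T′ eq = split-determines-parent T T′
  (splits-determine-split T T′ (cuts≡⇒⊆ T T′ eq) (cuts≡⇒⊆ T′ T (sym eq)))

familyOf-cong : {B : Fin s → Bipartition m} {C : Fin k → Bipartition m} →
                (∀ v → ∃[ u ] B v ≡ C u) → (∀ v → ∃[ u ] C v ≡ B u) → familyOf B ≡ familyOf C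
familyOf-cong {m = m} B⊆C C⊆B = ⊆-antisym (mono B⊆C) (mono C⊆B)
  where
  mono : ∀ {s k} {B : Fin s → Bipartition m} {C : Fin k → Bipartition m} →
         (∀ v → ∃[ u ] B v ≡ C u) → familyOf B ⊆ˢ familyOf C
  mono {B = B} B⊆C x∈ with v , eq ← ∈-familyOf⁻ {B = B} x∈ with u , eq′ ← B⊆C v = ∈-familyOf⁺ (u , trans eq eq′)

familyOf-enum : (F : Family m) → familyOf (bip m ∘ enum F) ≡ F
familyOf-enum {m} F = ⊆-antisym
  (λ x∈ → let r , eq = ∈-familyOf⁻ {B = bip m ∘ enum F} x∈ in subst (_∈ˢ F) (sym (bip-injective m eq)) (enum-∈ F r))
  (λ x∈F → let r , eq = enum-surjective x∈F in ∈-familyOf⁺ (r , cong (bip m) (sym eq)))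

-- `T₀` shows that the bound `m` is attained, so a maximum family has exactly `m` members and its
-- private edges form a tree.
maximum⇒cuts : (T₀ : Tree m) (F : Family m) → MaxMinimalSeparating {m} F → ∃[ T ] cuts T ≡ F
maximum⇒cuts {m} T₀ F (F-min , F-max) =
  let _ , _ , E = minimal⇒edges {m} {F} F-min
      ∣F∣≡m = ≤-antisym (minimal⇒size≤ {m} {F} F-min) (≤-trans (cuts-size T₀) (F-max (cuts T₀) (cuts-minimal T₀)))
      T , T⊆F , F⊆T = edges⇒tree ∣F∣≡m E
  in T , trans (familyOf-cong T⊆F F⊆T) (familyOf-enum F)

-- Bijection between codes and maximum families

cutsOfCode : ∀ m → Fin (suc m ^ (m ∸ 1)) → Family m
cutsOfCode m i = cuts (decode m (vector i))

cutsOfCode-injective : ∀ m → Injective _≡_ _≡_ (cutsOfCode m)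
cutsOfCode-injective m {i} {j} eq = vector-injective {suc m} {m ∸ 1} (decode-injective m (vector i) (vector j)
  (cuts-injective (decode m (vector i)) (decode m (vector j)) eq))

cutsOfCode-surjective : (F : Family m) → MaxMinimalSeparating {m} F → ∃[ i ] cutsOfCode m i ≡ F
cutsOfCode-surjective {m} F F-max =
  -- The constant code supplies one tree, as a witness that size `m` is reached.
  let T , T-eq = maximum⇒cuts (decode m (replicate _ zero)) F F-max
      c , c-eq = decode-surjective m T
      i , i-eq = vector-surjective c
      splits   = split-determined (decode m c) T c-eq
  in i , trans (cong (cuts ∘ decode m) i-eq)
           (trans (familyOf-cong {B = split (decode m c)} {split T} (λ v → v , splits v) (λ v → v , sym (splits v))) T-eq)

theorem2p3 : ∀ (m : ℕ) → ∃[ L ] (Unique L × length L ≡ suc m ^ (suc m ∸ 2) × (∀ (F : Family m) → (F ∈ L ⇔ MaxMinimalSeparating {m} F)))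
-- `suc m ∸ 2` reduces to `m ∸ 1`, the length of a code. For n = 1 the truncated exponent 0 and the
-- exponent -1 both give 1.
theorem2p3 m = L , tabulate⁺ (cutsOfCode-injective m) , length-tabulate (cutsOfCode m) , λ F → mk⇔
  (λ F∈L → let i , eq = ∈-tabulate⁻ F∈L in subst (MaxMinimalSeparating {m}) (sym eq) (cuts-maximum (decode m (vector i))))
  (λ F-max → let i , eq = cutsOfCode-surjective {m} F F-max in subst (_∈ L) eq (∈-tabulate⁺ {f = cutsOfCode m} i))
  where
  L : List (Family m)
  L = List.tabulate (cutsOfCode m)
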